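{- Let $\mathcal L$ be a preadditive $*$-autonomous category equipped with an exponential structure which has antiderivatives. Let $X,Y$ be objects of $\mathcal L$ and let $f\in\mathcal L({!}X\otimes X,Y)$ be such that $$f\,(\overline\partial_X\otimes \mathrm{Id}_X)\,\sigma_{23}=f\,(\overline\partial_X\otimes\mathrm{Id}_X)$$ as morphisms ${!}X\otimes X\otimes X\to Y$. Then there exists $g\in\mathcal L({!}X,Y)$ such that $g\,\overline\partial_X=f$.
   Context: $\mathbf k$ is a fixed commutative semi-ring. Composition of morphisms is written by juxtaposition. A $*$-autonomous category $\mathcal L$ (with tensor $\otimes$, unit $1$, symmetry $\sigma$) is preadditive if every hom-set $\mathcal L(X,Y)$ is a $\mathbf k$-module and composition and $\otimes$ are $\mathbf k$-bilinear on morphisms. The associativity and unit isomorphisms of $\otimes$ are left implicit, as if $\otimes$ were strict. Let $\mathcal L_{\mathsf{iso}}$ be the groupoid of objects and isomorphisms of $\mathcal L$. An exponential structure on $\mathcal L$ consists of a functor ${!}\_:\mathcal L_{\mathsf{iso}}\to\mathcal L_{\mathsf{iso}}$ together with families of morphisms of $\mathcal L$, natural with respect to isomorphisms: $w_X:{!}X\to 1$, $c_X:{!}X\to{!}X\otimes{!}X$, $\overline w_X:1\to{!}X$, $\overline c_X:{!}X\otimes{!}X\to{!}X$, $d_X:{!}X\to X$, $\overline d_X:X\to{!}X$, such that: - $({!}X,w_X,c_X,\overline w_X,\overline c_X)$ is a commutative (and cocommutative) bialgebra: $({!}X,w_X,c_X)$ is a commutative comonoid, $({!}X,\overline w_X,\overline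 c_X)$ is a commutative monoid, $c_X\overline c_X=(\overline c_X\otimes\overline c_X)(\mathrm{Id}_{{!}X}\otimes\sigma\otimes\mathrm{Id}_{{!}X})(c_X\otimes c_X)$, $w_X\overline w_X=\mathrm{Id}_1$, $w_X\overline c_X=w_X\otimes w_X$, $c_X\overline w_X=\overline w_X\otimes\overline w_X$; - $w_X\overline d_X=0$, $d_X\overline w_X=0$, $c_X\overline d_X=\overline d_X\otimes\overline w_X+\overline w_X\otimes\overline d_X$, $d_X\overline c_X=d_X\otimes w_X+w_X\otimes d_X$, and $d_X\overline d_X=\mathrm{Id}_X$. Define $\overline\partial_X=\overline c_X(\mathrm{Id}_{{!}X}\otimes\overline d_X)\in\mathcal L({!}X\otimes X,{!}X)$ and $\partial_X=(\mathrm{Id}_{{!}X}\otimes d_X)c_X\in\mathcal L({!}X,{!}X\otimes X)$. The exponential structure has antiderivatives if for each object $X$ the morphism $J_X=\mathrm{Id}_{{!}X}+\overline\partial_X\,\partial_X:{!}X\to{!}X$ is an isomorphism. Finally $\sigma_{23}=\mathrm{Id}_{{!}X}\otimes\sigma_{X,X}$ is the automorphism of ${!}X\otimes X\otimes X$ exchanging the last two factors. -}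

module Defs where

open import Algebra.Bundles using (CommutativeSemiring)
open import Algebra.Module.Bundles using (LeftSemimodule)
open import Algebra.Module.Structures using (IsLeftSemimodule)
import Algebra.Module.Morphism.Structures as ModuleMorphisms
open import Level using (Level; _⊔_; suc)
open import Relation.Binary.Core using (Rel)
open import Relation.Binary.Structures using (IsEquivalence)

private
  variable
    k ℓk o ℓ e o′ ℓ′ e′ : Level

-- Hom-sets are setoids: `_≈_` is the equality of morphisms.
record Category (o ℓ e : Level) : Set (suc (o ⊔ ℓ ⊔ e)) where
  infix  4 _≈_ _⇒_
  infixr 9 _∘_
  field
    Obj : Set o
    _⇒_ : Obj → Obj → Set ℓ
    _≈_ : ∀ {X Y} → Rel (X ⇒ Y) e
    id  : ∀ {X} → X ⇒ X
    _∘_ : ∀ {X Y Z} → Y ⇒ Z → X ⇒ Y → X ⇒ Z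

    isEquivalence : ∀ {X Y} → IsEquivalence (_≈_ {X} {Y})
    ∘-cong    : ∀ {X Y Z} {f f′ : Y ⇒ Z} {g g′ : X ⇒ Y} →
                f ≈ f′ → g ≈ g′ → f ∘ g ≈ f′ ∘ g′
    assoc     : ∀ {W X Y Z} {f : Y ⇒ Z} {g : X ⇒ Y} {h : W ⇒ X} →
                (f ∘ g) ∘ h ≈ f ∘ (g ∘ h)
    identityˡ : ∀ {X Y} {f : X ⇒ Y} → id ∘ f ≈ f
    identityʳ : ∀ {X Y} {f : X ⇒ Y} → f ∘ id ≈ f

  module Equiv {X Y : Obj} = IsEquivalence (isEquivalence {X} {Y})

record Functor (C : Category o ℓ e) (D : Category o′ ℓ′ e′) :
               Set (o ⊔ ℓ ⊔ e ⊔ o′ ⊔ ℓ′ ⊔ e′) where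
  private
    module C = Category C
    module D = Category D
  field
    F₀ : C.Obj → D.Obj
    F₁ : ∀ {X Y} → X C.⇒ Y → F₀ X D.⇒ F₀ Y
    F-resp-≈     : ∀ {X Y} {f g : X C.⇒ Y} → f C.≈ g → F₁ f D.≈ F₁ g
    identity     : ∀ {X} → F₁ (C.id {X}) D.≈ D.id
    homomorphism : ∀ {X Y Z} {f : Y C.⇒ Z} {g : X C.⇒ Y} →
                   F₁ (f C.∘ g) D.≈ F₁ f D.∘ F₁ g

module Isomorphisms (C : Category o ℓ e) where
  open Category C

  record IsIso {X Y : Obj} (f : X ⇒ Y) : Set (ℓ ⊔ e) where
    field
      inv  : Y ⇒ X
      isoˡ : inv ∘ f ≈ id
      isoʳ : f ∘ inv ≈ id

  infix 4 _≅_
  record _≅_ (X Y : Obj) : Set (ℓ ⊔ e) where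
    field
      from  : X ⇒ Y
      isIso : IsIso from
    open IsIso isIso public renaming (inv to to)

  open _≅_ public using (from; to)

  ≅-id : ∀ {X} → X ≅ X
  ≅-id = record
    { from  = id
    ; isIso = record { inv = id ; isoˡ = identityˡ ; isoʳ = identityʳ } }

  ≅-∘ : ∀ {X Y Z} → Y ≅ Z → X ≅ Y → X ≅ Z
  ≅-∘ i j = record
    { from  = from i ∘ from j
    ; isIso = record
      { inv  = to j ∘ to i
      ; isoˡ = cancel (_≅_.isoˡ i) (_≅_.isoˡ j)
      ; isoʳ = cancel (_≅_.isoʳ j) (_≅_.isoʳ i) } }
    where
    open Equiv
    cancel : ∀ {A B D} {a : B ⇒ A} {b : D ⇒ B} {b′ : B ⇒ D} {a′ : A ⇒ B} →
             b ∘ b′ ≈ id → a ∘ a′ ≈ id → (a ∘ b) ∘ (b′ ∘ a′) ≈ id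
    cancel p q = trans assoc
      (trans (∘-cong refl (trans (sym assoc)
                            (trans (∘-cong p refl) identityˡ))) q)

-- The groupoid of objects and isomorphisms.  Inverses being unique, two
-- isomorphisms are equal as soon as their forward morphisms are.
Core : Category o ℓ e → Category o (ℓ ⊔ e) e
Core C = record
  { Obj = Obj
  ; _⇒_ = _≅_
  ; _≈_ = λ i j → from i ≈ from j
  ; id  = ≅-id
  ; _∘_ = ≅-∘
  ; isEquivalence = record
    { refl = Equiv.refl ; sym = Equiv.sym ; trans = Equiv.trans }
  ; ∘-cong    = ∘-cong
  ; assoc     = assoc
  ; identityˡ = identityˡ
  ; identityʳ = identityʳ
  }
  where
  open Category C
  open Isomorphisms C

record SymmetricMonoidal (C : Category o ℓ e) : Set (o ⊔ ℓ ⊔ e) where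
  open Category C
  open Isomorphisms C
  infixr 10 _⊗₀_ _⊗₁_
  field
    _⊗₀_ : Obj → Obj → Obj
    _⊗₁_ : ∀ {X Y X′ Y′} → X ⇒ X′ → Y ⇒ Y′ → X ⊗₀ Y ⇒ X′ ⊗₀ Y′
    𝟏    : Obj

    ⊗-cong     : ∀ {X Y X′ Y′} {f f′ : X ⇒ X′} {g g′ : Y ⇒ Y′} →
                 f ≈ f′ → g ≈ g′ → f ⊗₁ g ≈ f′ ⊗₁ g′
    ⊗-identity : ∀ {X Y} → id {X} ⊗₁ id {Y} ≈ id
    ⊗-∘        : ∀ {X Y X′ Y′ X″ Y″} {f′ : X′ ⇒ X″} {g′ : Y′ ⇒ Y″}
                   {f : X ⇒ X′} {g : Y ⇒ Y′} →
                 (f′ ∘ f) ⊗₁ (g′ ∘ g) ≈ (f′ ⊗₁ g′) ∘ (f ⊗₁ g)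

    unitorˡ    : ∀ {X} → 𝟏 ⊗₀ X ≅ X
    unitorʳ    : ∀ {X} → X ⊗₀ 𝟏 ≅ X
    associator : ∀ {X Y Z} → (X ⊗₀ Y) ⊗₀ Z ≅ X ⊗₀ (Y ⊗₀ Z)
    σ          : ∀ {X Y} → X ⊗₀ Y ⇒ Y ⊗₀ X

  λ⇒ : ∀ {X} → 𝟏 ⊗₀ X ⇒ X
  λ⇒ = from unitorˡ
  λ⇐ : ∀ {X} → X ⇒ 𝟏 ⊗₀ X
  λ⇐ = to unitorˡ
  ρ⇒ : ∀ {X} → X ⊗₀ 𝟏 ⇒ X
  ρ⇒ = from unitorʳ
  ρ⇐ : ∀ {X} → X ⇒ X ⊗₀ 𝟏
  ρ⇐ = to unitorʳ
  α⇒ : ∀ {X Y Z} → (X ⊗₀ Y) ⊗₀ Z ⇒ X ⊗₀ (Y ⊗₀ Z)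
  α⇒ = from associator
  α⇐ : ∀ {X Y Z} → X ⊗₀ (Y ⊗₀ Z) ⇒ (X ⊗₀ Y) ⊗₀ Z
  α⇐ = to associator

  field
    unitorˡ-natural    : ∀ {X Y} {f : X ⇒ Y} → λ⇒ ∘ (id ⊗₁ f) ≈ f ∘ λ⇒
    unitorʳ-natural    : ∀ {X Y} {f : X ⇒ Y} → ρ⇒ ∘ (f ⊗₁ id) ≈ f ∘ ρ⇒
    associator-natural : ∀ {X Y Z X′ Y′ Z′}
                           {f : X ⇒ X′} {g : Y ⇒ Y′} {h : Z ⇒ Z′} →
                         α⇒ ∘ ((f ⊗₁ g) ⊗₁ h) ≈ (f ⊗₁ (g ⊗₁ h)) ∘ α⇒
    σ-natural          : ∀ {X Y X′ Y′} {f : X ⇒ X′} {g : Y ⇒ Y′} →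
                         σ ∘ (f ⊗₁ g) ≈ (g ⊗₁ f) ∘ σ

    triangle   : ∀ {X Y} → (id {X} ⊗₁ λ⇒ {Y}) ∘ α⇒ ≈ ρ⇒ ⊗₁ id
    pentagon   : ∀ {W X Y Z} →
                 (id {W} ⊗₁ α⇒ {X} {Y} {Z}) ∘ α⇒ ∘ (α⇒ ⊗₁ id) ≈ α⇒ ∘ α⇒
    hexagon    : ∀ {X Y Z} →
                 (id {Y} ⊗₁ σ {X} {Z}) ∘ α⇒ ∘ (σ ⊗₁ id) ≈ α⇒ ∘ σ ∘ α⇒
    σ-involutive : ∀ {X Y} → σ {Y} {X} ∘ σ {X} {Y} ≈ id

  -- Id ⊗ σ : exchange of the last two of three factors
  σ₂₃ : ∀ {X Y Z} → (X ⊗₀ Y) ⊗₀ Z ⇒ (X ⊗₀ Z) ⊗₀ Y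
  σ₂₃ = α⇐ ∘ (id ⊗₁ σ) ∘ α⇒

  -- Id ⊗ σ ⊗ Id : exchange of the middle two of four factors
  mid : ∀ {W X Y Z} → (W ⊗₀ X) ⊗₀ (Y ⊗₀ Z) ⇒ (W ⊗₀ Y) ⊗₀ (X ⊗₀ Z)
  mid = α⇐ ∘ (id ⊗₁ (α⇒ ∘ (σ ⊗₁ id) ∘ α⇐)) ∘ α⇒

record StarAutonomous (C : Category o ℓ e) : Set (o ⊔ ℓ ⊔ e) where
  open Category C
  open Isomorphisms C
  field
    symmetricMonoidal : SymmetricMonoidal C
  open SymmetricMonoidal symmetricMonoidal public

  infixr 5 _⊸_
  field
    _⊸_        : Obj → Obj → Obj
    ev         : ∀ {X Y} → (X ⊸ Y) ⊗₀ X ⇒ Y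
    cur        : ∀ {X Y Z} → Z ⊗₀ X ⇒ Y → Z ⇒ X ⊸ Y
    cur-β      : ∀ {X Y Z} {f : Z ⊗₀ X ⇒ Y} → ev ∘ (cur f ⊗₁ id) ≈ f
    cur-unique : ∀ {X Y Z} {f : Z ⊗₀ X ⇒ Y} {g : Z ⇒ X ⊸ Y} →
                 ev ∘ (g ⊗₁ id) ≈ f → g ≈ cur f

    ⊥          : Obj

  η : ∀ X → X ⇒ (X ⊸ ⊥) ⊸ ⊥
  η X = cur (ev ∘ σ)

  field
    η-isIso    : ∀ X → IsIso (η X)

record Preadditive (K : CommutativeSemiring k ℓk) {C : Category o ℓ e}
                   (S : StarAutonomous C) : Set (k ⊔ ℓk ⊔ o ⊔ ℓ ⊔ e) where
  open CommutativeSemiring K using (Carrier; semiring)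
  open Category C
  open StarAutonomous S
  infixl 6 _+_
  infixr 7 _·_
  field
    _+_ : ∀ {X Y} → X ⇒ Y → X ⇒ Y → X ⇒ Y
    0ₘ  : ∀ {X Y} → X ⇒ Y
    _·_ : ∀ {X Y} → Carrier → X ⇒ Y → X ⇒ Y
    isLeftSemimodule : ∀ {X Y} →
      IsLeftSemimodule semiring (_≈_ {X} {Y}) _+_ 0ₘ _·_

  homSemimodule : Obj → Obj → LeftSemimodule semiring ℓ e
  homSemimodule X Y = record { isLeftSemimodule = isLeftSemimodule {X} {Y} }

  Linear : ∀ {X Y X′ Y′} → (X ⇒ Y → X′ ⇒ Y′) → Set (k ⊔ ℓ ⊔ e)
  Linear {X} {Y} {X′} {Y′} =
    ModuleMorphisms.LeftSemimoduleMorphisms.IsLeftSemimoduleHomomorphism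
      (LeftSemimodule.rawLeftSemimodule (homSemimodule X Y))
      (LeftSemimodule.rawLeftSemimodule (homSemimodule X′ Y′))

  field
    ∘-linearˡ : ∀ {X Y Z} (g : X ⇒ Y) → Linear (λ (f : Y ⇒ Z) → f ∘ g)
    ∘-linearʳ : ∀ {X Y Z} (f : Y ⇒ Z) → Linear (λ (g : X ⇒ Y) → f ∘ g)
    ⊗-linearˡ : ∀ {X Y X′ Y′} (g : Y ⇒ Y′) → Linear (λ (f : X ⇒ X′) → f ⊗₁ g)
    ⊗-linearʳ : ∀ {X Y X′ Y′} (f : X ⇒ X′) → Linear (λ (g : Y ⇒ Y′) → f ⊗₁ g)

module Bialgebras {C : Category o ℓ e} (M : SymmetricMonoidal C) where
  open Category C
  open SymmetricMonoidal M

  record IsCommutativeComonoid (A : Obj) (w : A ⇒ 𝟏) (c : A ⇒ A ⊗₀ A) :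
                               Set e where
    field
      counitˡ       : λ⇒ ∘ (w ⊗₁ id) ∘ c ≈ id
      counitʳ       : ρ⇒ ∘ (id ⊗₁ w) ∘ c ≈ id
      coassociative : α⇒ ∘ (c ⊗₁ id) ∘ c ≈ (id ⊗₁ c) ∘ c
      cocommutative : σ ∘ c ≈ c

  record IsCommutativeMonoid (A : Obj) (w̄ : 𝟏 ⇒ A) (c̄ : A ⊗₀ A ⇒ A) :
                             Set e where
    field
      unitˡ       : c̄ ∘ (w̄ ⊗₁ id) ∘ λ⇐ ≈ id
      unitʳ       : c̄ ∘ (id ⊗₁ w̄) ∘ ρ⇐ ≈ id
      associative : c̄ ∘ (c̄ ⊗₁ id) ≈ c̄ ∘ (id ⊗₁ c̄) ∘ α⇒
      commutative : c̄ ∘ σ ≈ c̄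

  record IsCommutativeBialgebra (A : Obj) (w : A ⇒ 𝟏) (c : A ⇒ A ⊗₀ A)
                                (w̄ : 𝟏 ⇒ A) (c̄ : A ⊗₀ A ⇒ A) : Set e where
    field
      isCommutativeComonoid : IsCommutativeComonoid A w c
      isCommutativeMonoid   : IsCommutativeMonoid A w̄ c̄
      c∘c̄ : c ∘ c̄ ≈ (c̄ ⊗₁ c̄) ∘ mid ∘ (c ⊗₁ c)
      w∘w̄ : w ∘ w̄ ≈ id
      w∘c̄ : w ∘ c̄ ≈ λ⇒ ∘ (w ⊗₁ w)
      c∘w̄ : c ∘ w̄ ≈ (w̄ ⊗₁ w̄) ∘ λ⇐
    open IsCommutativeComonoid isCommutativeComonoid public
    open IsCommutativeMonoid isCommutativeMonoid public

record ExponentialStructure {K : CommutativeSemiring k ℓk} {C : Category o ℓ e}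
                            {S : StarAutonomous C} (P : Preadditive K S) :
                            Set (o ⊔ ℓ ⊔ e) where
  open Category C
  open Isomorphisms C
  open StarAutonomous S
  open Preadditive P
  open Bialgebras symmetricMonoidal
  field
    !-functor : Functor (Core C) (Core C)

  infix 12 !_
  !_ : Obj → Obj
  !_ = Functor.F₀ !-functor

  !₁ : ∀ {X Y} → X ≅ Y → ! X ≅ ! Y
  !₁ = Functor.F₁ !-functor

  field
    w : ∀ X → ! X ⇒ 𝟏
    c : ∀ X → ! X ⇒ ! X ⊗₀ ! X
    w̄ : ∀ X → 𝟏 ⇒ ! X
    c̄ : ∀ X → ! X ⊗₀ ! X ⇒ ! X
    d : ∀ X → ! X ⇒ X
    d̄ : ∀ X → X ⇒ ! X

    w-natural : ∀ {X Y} (i : X ≅ Y) → w Y ∘ from (!₁ i) ≈ w X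
    c-natural : ∀ {X Y} (i : X ≅ Y) →
                c Y ∘ from (!₁ i) ≈ (from (!₁ i) ⊗₁ from (!₁ i)) ∘ c X
    w̄-natural : ∀ {X Y} (i : X ≅ Y) → from (!₁ i) ∘ w̄ X ≈ w̄ Y
    c̄-natural : ∀ {X Y} (i : X ≅ Y) →
                from (!₁ i) ∘ c̄ X ≈ c̄ Y ∘ (from (!₁ i) ⊗₁ from (!₁ i))
    d-natural : ∀ {X Y} (i : X ≅ Y) → d Y ∘ from (!₁ i) ≈ from i ∘ d X
    d̄-natural : ∀ {X Y} (i : X ≅ Y) → from (!₁ i) ∘ d̄ X ≈ d̄ Y ∘ from i

    isCommutativeBialgebra : ∀ X →
      IsCommutativeBialgebra (! X) (w X) (c X) (w̄ X) (c̄ X)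

    w∘d̄ : ∀ X → w X ∘ d̄ X ≈ 0ₘ
    d∘w̄ : ∀ X → d X ∘ w̄ X ≈ 0ₘ
    c∘d̄ : ∀ X → c X ∘ d̄ X ≈ (d̄ X ⊗₁ w̄ X) ∘ ρ⇐ + (w̄ X ⊗₁ d̄ X) ∘ λ⇐
    d∘c̄ : ∀ X → d X ∘ c̄ X ≈ ρ⇒ ∘ (d X ⊗₁ w X) + λ⇒ ∘ (w X ⊗₁ d X)
    d∘d̄ : ∀ X → d X ∘ d̄ X ≈ id

  ∂̄ : ∀ X → ! X ⊗₀ X ⇒ ! X
  ∂̄ X = c̄ X ∘ (id ⊗₁ d̄ X)

  ∂ : ∀ X → ! X ⇒ ! X ⊗₀ X
  ∂ X = (id ⊗₁ d X) ∘ c X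

  J : ∀ X → ! X ⇒ ! X
  J X = id + ∂̄ X ∘ ∂ X

  HasAntiderivatives : Set (o ⊔ ℓ ⊔ e)
  HasAntiderivatives = ∀ X → IsIso (J X)

{-# OPTIONS --safe #-}
module Submission where

-- Write N = ∂̄ ∂, so that J = Id + N, and Q = (∂̄ ⊗ Id) σ₂₃ (∂ ⊗ Id).  The
-- bialgebra axioms give ∂ ∂̄ = Id + Q, and f Q = f (N ⊗ Id) by the symmetry of
-- f; hence f ∂ ∂̄ = f (J ⊗ Id).  Commutativity and cocommutativity likewise give
-- N ∂̄ = ∂̄ (J ⊗ Id) and ∂ N = (J ⊗ Id) ∂, so N ⊗ Id commutes with Q, and
-- therefore J⁻¹ ⊗ Id commutes with ∂ ∂̄.  Then g = f (J⁻¹ ⊗ Id) ∂ satisfies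
-- g ∂̄ = f ∂ ∂̄ (J⁻¹ ⊗ Id) = f (J ⊗ Id) (J⁻¹ ⊗ Id) = f.

open import Defs
open import Algebra.Bundles using (CommutativeSemiring)
open import Algebra.Module.Bundles using (LeftSemimodule)
open import Algebra.Module.Morphism.Structures
  using (module LeftSemimoduleMorphisms)
open import Data.Product using (∃-syntax; _,_)
open import Relation.Binary.Bundles using (Setoid)
import Relation.Binary.Reasoning.Setoid as SetoidReasoning

-- Equational reasoning in hom-setoids.

module HomReasoning {o ℓ e} (C : Category o ℓ e) where
  open Category C
  open Equiv public using (refl; sym; trans)

  module _ {X Y : Obj} where
    private
      homSetoid : Setoid ℓ e
      homSetoid = record { isEquivalence = isEquivalence {X} {Y} }
    open SetoidReasoning homSetoid public

  private
    variable
      A B D : Obj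
      f g h k a b a′ b′ : A ⇒ B

  infixr 4 refl⟩∘⟨_
  infixl 5 _⟩∘⟨refl

  refl⟩∘⟨_ : {f : B ⇒ D} {g h : A ⇒ B} → g ≈ h → f ∘ g ≈ f ∘ h
  refl⟩∘⟨_ = ∘-cong refl

  _⟩∘⟨refl : {f g : B ⇒ D} {h : A ⇒ B} → f ≈ g → f ∘ h ≈ g ∘ h
  p ⟩∘⟨refl = ∘-cong p refl

  pullˡ : f ∘ g ≈ h → f ∘ g ∘ k ≈ h ∘ k
  pullˡ p = trans (sym assoc) (p ⟩∘⟨refl)

  pullʳ : g ∘ k ≈ h → (f ∘ g) ∘ k ≈ f ∘ h
  pullʳ p = trans assoc (refl⟩∘⟨ p)

  extendʳ : f ∘ g ≈ a ∘ b → f ∘ g ∘ k ≈ a ∘ b ∘ k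
  extendʳ p = trans (pullˡ p) assoc

  cancelˡ : f ∘ g ≈ id → f ∘ g ∘ k ≈ k
  cancelˡ p = trans (pullˡ p) identityˡ

  cancelʳ : f ∘ g ≈ id → (k ∘ f) ∘ g ≈ k
  cancelʳ p = trans (pullʳ p) identityʳ

  id-comm : id ∘ f ≈ f ∘ id
  id-comm = trans identityˡ (sym identityʳ)

  -- Pasting of two squares: naturality of a composite such as `σ₂₃` or `mid` is assembled from that
  -- of its factors.
  glue : a′ ∘ g ≈ h ∘ b′ → a ∘ f ≈ g ∘ b → (a′ ∘ a) ∘ f ≈ h ∘ b′ ∘ b
  glue p q = trans (pullʳ q) (extendʳ p)

  cancel-epi : f ∘ k ≈ id → g ∘ f ≈ h ∘ f → g ≈ h
  cancel-epi s p = trans (sym (cancelʳ s)) (trans (p ⟩∘⟨refl) (cancelʳ s))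

  cancel-mono : k ∘ f ≈ id → f ∘ g ≈ f ∘ h → g ≈ h
  cancel-mono r p = trans (sym (cancelˡ r)) (trans (refl⟩∘⟨ p) (cancelˡ r))

  inverse-square : a′ ∘ a ≈ id → b ∘ b′ ≈ id →
                   a ∘ f ≈ g ∘ b → a′ ∘ g ≈ f ∘ b′
  inverse-square {a′ = a′} {a = a} {b = b} {b′ = b′} {f = f} {g = g} p q s = begin
    a′ ∘ g                ≈⟨ refl⟩∘⟨ cancelʳ q ⟨
    a′ ∘ (g ∘ b) ∘ b′     ≈⟨ refl⟩∘⟨ s ⟩∘⟨refl ⟨
    a′ ∘ (a ∘ f) ∘ b′     ≈⟨ refl⟩∘⟨ assoc ⟩
    a′ ∘ a ∘ f ∘ b′       ≈⟨ cancelˡ p ⟩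
    f ∘ b′                ∎

-- Coherence in a symmetric monoidal category.

module Coherence {o ℓ e} {C : Category o ℓ e} (M : SymmetricMonoidal C) where
  open Category C
  open Isomorphisms C
  open SymmetricMonoidal M
  open HomReasoning C

  private
    variable
      A B V W X Y Z : Obj
      f g h k a b a′ b′ : A ⇒ B

  infixr 6 refl⟩⊗⟨_
  infixl 7 _⟩⊗⟨refl

  refl⟩⊗⟨_ : {f : A ⇒ B} {g h : V ⇒ W} → g ≈ h → f ⊗₁ g ≈ f ⊗₁ h
  refl⟩⊗⟨_ = ⊗-cong refl

  _⟩⊗⟨refl : {f g : A ⇒ B} {h : V ⇒ W} → f ≈ g → f ⊗₁ h ≈ g ⊗₁ h
  p ⟩⊗⟨refl = ⊗-cong p refl

  ⊗-square : f ∘ g ≈ h ∘ k → a ∘ b ≈ a′ ∘ b′ →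
             (f ⊗₁ a) ∘ (g ⊗₁ b) ≈ (h ⊗₁ a′) ∘ (k ⊗₁ b′)
  ⊗-square p q = trans (sym ⊗-∘) (trans (⊗-cong p q) ⊗-∘)

  ⊗-merge : f ∘ g ≈ h → a ∘ b ≈ k → (f ⊗₁ a) ∘ (g ⊗₁ b) ≈ h ⊗₁ k
  ⊗-merge p q = trans (sym ⊗-∘) (⊗-cong p q)

  split-⊗ : (f ⊗₁ id) ∘ (id ⊗₁ g) ≈ f ⊗₁ g
  split-⊗ = ⊗-merge identityʳ identityˡ

  λ-isoˡ : λ⇐ ∘ λ⇒ {X} ≈ id
  λ-isoˡ = _≅_.isoˡ unitorˡ
  λ-isoʳ : λ⇒ {X} ∘ λ⇐ ≈ id
  λ-isoʳ = _≅_.isoʳ unitorˡ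
  ρ-isoˡ : ρ⇐ ∘ ρ⇒ {X} ≈ id
  ρ-isoˡ = _≅_.isoˡ unitorʳ
  ρ-isoʳ : ρ⇒ {X} ∘ ρ⇐ ≈ id
  ρ-isoʳ = _≅_.isoʳ unitorʳ
  α-isoˡ : α⇐ ∘ α⇒ {X} {Y} {Z} ≈ id
  α-isoˡ = _≅_.isoˡ associator
  α-isoʳ : α⇒ {X} {Y} {Z} ∘ α⇐ ≈ id
  α-isoʳ = _≅_.isoʳ associator

  α⇐-natural : α⇐ ∘ (f ⊗₁ (g ⊗₁ h)) ≈ ((f ⊗₁ g) ⊗₁ h) ∘ α⇐
  α⇐-natural = inverse-square α-isoˡ α-isoʳ associator-natural

  σ₂₃-natural : σ₂₃ ∘ ((f ⊗₁ g) ⊗₁ h) ≈ ((f ⊗₁ h) ⊗₁ g) ∘ σ₂₃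
  σ₂₃-natural =
    glue α⇐-natural (glue (⊗-square id-comm σ-natural) associator-natural)

  mid-natural : mid ∘ ((f ⊗₁ g) ⊗₁ (h ⊗₁ k)) ≈ ((f ⊗₁ h) ⊗₁ (g ⊗₁ k)) ∘ mid
  mid-natural =
    glue α⇐-natural (glue (⊗-square id-comm
      (glue associator-natural
        (glue (⊗-square σ-natural id-comm) α⇐-natural))) associator-natural)

  -- `ρ⇒` is a natural isomorphism to the identity functor. A unit equation may therefore be checked
  -- after adding a factor `𝟏`, which makes room for the triangle, pentagon and hexagon.
  ⊗𝟏-faithful : f ⊗₁ id {𝟏} ≈ g ⊗₁ id → f ≈ g
  ⊗𝟏-faithful p = cancel-epi ρ-isoʳ
    (trans (sym unitorʳ-natural) (trans (refl⟩∘⟨ p) unitorʳ-natural))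

  𝟏⊗-faithful : id {𝟏} ⊗₁ f ≈ id ⊗₁ g → f ≈ g
  𝟏⊗-faithful p = cancel-epi λ-isoʳ
    (trans (sym unitorˡ-natural) (trans (refl⟩∘⟨ p) unitorˡ-natural))

  -- Kelly's consequences of the triangle and the pentagon.
  unitorʳ-⊗ : (id {X} ⊗₁ ρ⇒ {Y}) ∘ α⇒ ≈ ρ⇒
  unitorʳ-⊗ {X} {Y} = ⊗𝟏-faithful (cancel-mono α-isoˡ (begin
    α⇒ ∘ (((id ⊗₁ ρ⇒) ∘ α⇒) ⊗₁ id)
      ≈⟨ refl⟩∘⟨ ⊗-merge refl identityˡ ⟨
    α⇒ ∘ ((id ⊗₁ ρ⇒) ⊗₁ id) ∘ (α⇒ ⊗₁ id)
      ≈⟨ extendʳ associator-natural ⟩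
    (id ⊗₁ (ρ⇒ ⊗₁ id)) ∘ α⇒ ∘ (α⇒ ⊗₁ id)
      ≈⟨ pullˡ (⊗-merge identityˡ triangle) ⟨
    (id ⊗₁ (id ⊗₁ λ⇒)) ∘ (id ⊗₁ α⇒) ∘ α⇒ ∘ (α⇒ ⊗₁ id)
      ≈⟨ refl⟩∘⟨ pentagon ⟩
    (id ⊗₁ (id ⊗₁ λ⇒)) ∘ α⇒ ∘ α⇒
      ≈⟨ extendʳ associator-natural ⟨
    α⇒ ∘ ((id ⊗₁ id) ⊗₁ λ⇒) ∘ α⇒
      ≈⟨ refl⟩∘⟨ ⊗-identity ⟩⊗⟨refl ⟩∘⟨refl ⟩
    α⇒ ∘ (id ⊗₁ λ⇒) ∘ α⇒
      ≈⟨ refl⟩∘⟨ triangle ⟩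
    α⇒ ∘ (ρ⇒ ⊗₁ id) ∎))

  unitorˡ-⊗ : λ⇒ ∘ α⇒ {𝟏} {X} {Y} ≈ λ⇒ ⊗₁ id
  unitorˡ-⊗ {X} {Y} = 𝟏⊗-faithful
    -- Precomposing with two invertible associators exposes one side of the pentagon.
    (cancel-epi α-isoʳ (cancel-epi ⊗α-iso (begin
    ((id ⊗₁ (λ⇒ ∘ α⇒)) ∘ α⇒) ∘ (α⇒ ⊗₁ id)
      ≈⟨ assoc ⟩
    (id ⊗₁ (λ⇒ ∘ α⇒)) ∘ α⇒ ∘ (α⇒ ⊗₁ id)
      ≈⟨ pullˡ (⊗-merge identityˡ refl) ⟨
    (id ⊗₁ λ⇒) ∘ (id ⊗₁ α⇒) ∘ α⇒ ∘ (α⇒ ⊗₁ id)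
      ≈⟨ refl⟩∘⟨ pentagon ⟩
    (id ⊗₁ λ⇒) ∘ α⇒ ∘ α⇒
      ≈⟨ pullˡ triangle ⟩
    (ρ⇒ ⊗₁ id) ∘ α⇒
      ≈⟨ refl⟩⊗⟨ ⊗-identity ⟩∘⟨refl ⟨
    (ρ⇒ ⊗₁ (id ⊗₁ id)) ∘ α⇒
      ≈⟨ associator-natural ⟨
    α⇒ ∘ ((ρ⇒ ⊗₁ id) ⊗₁ id)
      ≈⟨ refl⟩∘⟨ ⊗-merge triangle identityˡ ⟨
    α⇒ ∘ ((id ⊗₁ λ⇒) ⊗₁ id) ∘ (α⇒ ⊗₁ id)
      ≈⟨ pullˡ associator-natural ⟩
    ((id ⊗₁ (λ⇒ ⊗₁ id)) ∘ α⇒) ∘ (α⇒ ⊗₁ id) ∎)))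
    where
    ⊗α-iso : (α⇒ {𝟏} {𝟏} {X} ⊗₁ id {Y}) ∘ (α⇐ ⊗₁ id) ≈ id
    ⊗α-iso = trans (⊗-merge α-isoʳ identityˡ) ⊗-identity

  -- The hexagon with `𝟏` in its last two places, read through `λ⇒`: naturality and `unitorˡ-⊗`
  -- remove everything but one symmetry on each side.
  unitorˡ-σ : λ⇒ ∘ σ ≈ ρ⇒ {X}
  unitorˡ-σ = ⊗𝟏-faithful (cancel-mono σ-involutive (begin
    σ ∘ ((λ⇒ ∘ σ) ⊗₁ id)
      ≈⟨ refl⟩∘⟨ ⊗-merge refl identityˡ ⟨
    σ ∘ (λ⇒ ⊗₁ id) ∘ (σ ⊗₁ id)
      ≈⟨ refl⟩∘⟨ pullˡ unitorˡ-⊗ ⟨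
    σ ∘ λ⇒ ∘ α⇒ ∘ (σ ⊗₁ id)
      ≈⟨ extendʳ unitorˡ-natural ⟨
    λ⇒ ∘ (id ⊗₁ σ) ∘ α⇒ ∘ (σ ⊗₁ id)
      ≈⟨ refl⟩∘⟨ hexagon ⟩
    λ⇒ ∘ α⇒ ∘ σ ∘ α⇒
      ≈⟨ pullˡ unitorˡ-⊗ ⟩
    (λ⇒ ⊗₁ id) ∘ σ ∘ α⇒
      ≈⟨ extendʳ σ-natural ⟨
    σ ∘ (id ⊗₁ λ⇒) ∘ α⇒
      ≈⟨ refl⟩∘⟨ triangle ⟩
    σ ∘ (ρ⇒ ⊗₁ id) ∎))

  unitorˡ≈unitorʳ : λ⇒ {𝟏} ≈ ρ⇒
  unitorˡ≈unitorʳ = ⊗𝟏-faithful (begin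
    λ⇒ ⊗₁ id            ≈⟨ unitorˡ-⊗ ⟨
    -- Naturality of `λ⇒` at the morphism `λ⇒`, with the outer `λ⇒` cancelled, identifies `id ⊗₁ λ⇒`
    -- with the unitor at `𝟏 ⊗₀ 𝟏`.
    λ⇒ ∘ α⇒             ≈⟨ cancel-mono λ-isoˡ unitorˡ-natural ⟩∘⟨refl ⟨
    (id ⊗₁ λ⇒) ∘ α⇒     ≈⟨ triangle ⟩
    ρ⇒ ⊗₁ id            ∎)

  σ-𝟏 : σ {𝟏} {𝟏} ≈ id
  σ-𝟏 = cancel-mono λ-isoˡ
    (trans unitorˡ-σ (trans (sym unitorˡ≈unitorʳ) (sym identityʳ)))

  -- This is the origin of the crossing in `Q`: the term `d̄ ⊗ w̄` of `c ∘ d̄` puts a unit in the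
  -- last place.
  mid-unitorʳ : (id ⊗₁ ρ⇒) ∘ mid {W} {X} {Y} {𝟏} ≈ σ₂₃ ∘ (id ⊗₁ ρ⇒)
  mid-unitorʳ = begin
    (id ⊗₁ ρ⇒) ∘ α⇐ ∘ (id ⊗₁ (α⇒ ∘ (σ ⊗₁ id) ∘ α⇐)) ∘ α⇒
      ≈⟨ ⊗-identity ⟩⊗⟨refl ⟩∘⟨refl ⟨
    ((id ⊗₁ id) ⊗₁ ρ⇒) ∘ α⇐ ∘ (id ⊗₁ (α⇒ ∘ (σ ⊗₁ id) ∘ α⇐)) ∘ α⇒
      ≈⟨ extendʳ α⇐-natural ⟨
    α⇐ ∘ (id ⊗₁ (id ⊗₁ ρ⇒)) ∘ (id ⊗₁ (α⇒ ∘ (σ ⊗₁ id) ∘ α⇐)) ∘ α⇒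
      ≈⟨ refl⟩∘⟨ extendʳ (⊗-square refl swap) ⟩
    α⇐ ∘ (id ⊗₁ σ) ∘ (id ⊗₁ (id ⊗₁ ρ⇒)) ∘ α⇒
      ≈⟨ refl⟩∘⟨ refl⟩∘⟨ associator-natural ⟨
    α⇐ ∘ (id ⊗₁ σ) ∘ α⇒ ∘ ((id ⊗₁ id) ⊗₁ ρ⇒)
      ≈⟨ refl⟩∘⟨ refl⟩∘⟨ refl⟩∘⟨ ⊗-identity ⟩⊗⟨refl ⟩
    α⇐ ∘ (id ⊗₁ σ) ∘ α⇒ ∘ (id ⊗₁ ρ⇒)
      ≈⟨ trans assoc (refl⟩∘⟨ assoc) ⟨
    σ₂₃ ∘ (id ⊗₁ ρ⇒) ∎
    where
    swap : (id ⊗₁ ρ⇒) ∘ α⇒ ∘ (σ {X} {Y} ⊗₁ id) ∘ α⇐ ≈ σ ∘ (id ⊗₁ ρ⇒)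
    swap = begin
      (id ⊗₁ ρ⇒) ∘ α⇒ ∘ (σ ⊗₁ id) ∘ α⇐   ≈⟨ pullˡ unitorʳ-⊗ ⟩
      ρ⇒ ∘ (σ ⊗₁ id) ∘ α⇐                 ≈⟨ extendʳ unitorʳ-natural ⟩
      σ ∘ ρ⇒ ∘ α⇐                         ≈⟨ refl⟩∘⟨ unitorʳ-⊗ ⟩∘⟨refl ⟨
      σ ∘ ((id ⊗₁ ρ⇒) ∘ α⇒) ∘ α⇐          ≈⟨ refl⟩∘⟨ cancelʳ α-isoʳ ⟩
      σ ∘ (id ⊗₁ ρ⇒)                      ∎

  -- The only symmetry inside `mid` is here `σ` at `𝟏`, an identity by `σ-𝟏`, and the associators
  -- cancel. It yields the identity term of `∂ ∘ ∂̄`.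
  mid-𝟏 : mid {W} {𝟏} {𝟏} {Z} ≈ id
  mid-𝟏 = begin
    α⇐ ∘ (id ⊗₁ (α⇒ ∘ (σ ⊗₁ id) ∘ α⇐)) ∘ α⇒
      ≈⟨ refl⟩∘⟨ refl⟩⊗⟨ (refl⟩∘⟨ σ-𝟏 ⟩⊗⟨refl ⟩∘⟨refl) ⟩∘⟨refl ⟩
    α⇐ ∘ (id ⊗₁ (α⇒ ∘ (id ⊗₁ id) ∘ α⇐)) ∘ α⇒
      ≈⟨ refl⟩∘⟨ refl⟩⊗⟨ (refl⟩∘⟨ trans (⊗-identity ⟩∘⟨refl) identityˡ) ⟩∘⟨refl ⟩
    α⇐ ∘ (id ⊗₁ (α⇒ ∘ α⇐)) ∘ α⇒
      ≈⟨ refl⟩∘⟨ trans (refl⟩⊗⟨ α-isoʳ) ⊗-identity ⟩∘⟨refl ⟩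
    α⇐ ∘ id ∘ α⇒
      ≈⟨ refl⟩∘⟨ identityˡ ⟩
    α⇐ ∘ α⇒
      ≈⟨ α-isoˡ ⟩
    id ∎

-- Bilinearity of composition and tensor.

module Additive {k ℓk o ℓ e} {K : CommutativeSemiring k ℓk} {C : Category o ℓ e}
                {S : StarAutonomous C} (P : Preadditive K S) where
  open Category C
  open StarAutonomous S
  open Preadditive P

  private
    module Homs {X Y : Obj} = LeftSemimodule (homSemimodule X Y)
    module Linearity {X Y X′ Y′ : Obj} =
      LeftSemimoduleMorphisms.IsLeftSemimoduleHomomorphism
        {M₁ = LeftSemimodule.rawLeftSemimodule (homSemimodule X Y)}
        {M₂ = LeftSemimodule.rawLeftSemimodule (homSemimodule X′ Y′)}

    variable
      A B D V W : Obj
      f g h : A ⇒ B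

  open Homs public using ()
    renaming (+ᴹ-cong to +-cong; +ᴹ-identityˡ to +-identityˡ;
              +ᴹ-identityʳ to +-identityʳ; +ᴹ-comm to +-comm)

  ∘-distribʳ-+ : (f + g) ∘ h ≈ f ∘ h + g ∘ h
  ∘-distribʳ-+ {h = h} = Linearity.+ᴹ-homo (∘-linearˡ h) _ _

  ∘-distribˡ-+ : f ∘ (g + h) ≈ f ∘ g + f ∘ h
  ∘-distribˡ-+ {f = f} = Linearity.+ᴹ-homo (∘-linearʳ f) _ _

  ⊗-distribʳ-+ : (f + g) ⊗₁ h ≈ f ⊗₁ h + g ⊗₁ h
  ⊗-distribʳ-+ {h = h} = Linearity.+ᴹ-homo (⊗-linearˡ h) _ _

  ⊗-distribˡ-+ : f ⊗₁ (g + h) ≈ f ⊗₁ g + f ⊗₁ h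
  ⊗-distribˡ-+ {f = f} = Linearity.+ᴹ-homo (⊗-linearʳ f) _ _

  ∘-zeroˡ : 0ₘ {B} {D} ∘ g ≈ 0ₘ {A}
  ∘-zeroˡ {g = g} = Linearity.0ᴹ-homo (∘-linearˡ g)

  ∘-zeroʳ : f ∘ 0ₘ {A} {B} ≈ 0ₘ {A} {D}
  ∘-zeroʳ {f = f} = Linearity.0ᴹ-homo (∘-linearʳ f)

  ⊗-zeroʳ : f ⊗₁ 0ₘ {A} {B} ≈ 0ₘ {V ⊗₀ A} {W ⊗₀ B}
  ⊗-zeroʳ {f = f} = Linearity.0ᴹ-homo (⊗-linearʳ f)

-- Commutation relations between `∂` and `∂̄`.

module Derivatives {k ℓk o ℓ e} {K : CommutativeSemiring k ℓk}
                   {C : Category o ℓ e} {S : StarAutonomous C}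
                   {P : Preadditive K S} (E : ExponentialStructure P) where
  open Category C
  open StarAutonomous S
  open Preadditive P
  open ExponentialStructure E
  open HomReasoning C
  open Coherence symmetricMonoidal
  open Additive P
  open Bialgebras symmetricMonoidal

  private
    module B X = IsCommutativeBialgebra (isCommutativeBialgebra X)

    variable
      X A B B′ D : Obj
      φ φ′ : ! X ⊗₀ ! X ⇒ X
      ψ ψ′ : X ⇒ ! X ⊗₀ ! X

  Q : ∀ X → ! X ⊗₀ X ⇒ ! X ⊗₀ X
  Q X = (∂̄ X ⊗₁ id) ∘ σ₂₃ ∘ (∂ X ⊗₁ id)

  private
    -- ∂ ∘ ∂̄ is Convolve (d ∘ c̄) (c ∘ d̄); both arguments are sums of two terms.
    Convolve : (! X ⊗₀ ! X ⇒ X) → (X ⇒ ! X ⊗₀ ! X) → ! X ⊗₀ X ⇒ ! X ⊗₀ X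
    Convolve {X} φ ψ = (c̄ X ⊗₁ φ) ∘ mid ∘ (c X ⊗₁ ψ)

    convolve-cong : φ ≈ φ′ → ψ ≈ ψ′ → Convolve φ ψ ≈ Convolve φ′ ψ′
    convolve-cong p q = ∘-cong (⊗-cong refl p) (refl⟩∘⟨ ⊗-cong refl q)

    convolve-+ˡ : Convolve (φ + φ′) ψ ≈ Convolve φ ψ + Convolve φ′ ψ
    convolve-+ˡ = trans (⊗-distribˡ-+ ⟩∘⟨refl) ∘-distribʳ-+

    convolve-+ʳ : Convolve φ (ψ + ψ′) ≈ Convolve φ ψ + Convolve φ ψ′
    convolve-+ʳ = trans (refl⟩∘⟨ trans (refl⟩∘⟨ ⊗-distribˡ-+) ∘-distribˡ-+)
                        ∘-distribˡ-+

    -- By naturality of `mid`, `a′` is absorbed next to the product and `a` next to the coproduct,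
    -- while `b` meets `b′`. Each cross term of `∂ ∘ ∂̄` is thus decided by the single composite
    -- `b ∘ b′`.
    convolve-⊗ : {a : ! X ⇒ A} {b : ! X ⇒ B} {u : A ⊗₀ B ⇒ X}
                 {a′ : D ⇒ ! X} {b′ : B′ ⇒ ! X} {v : X ⇒ D ⊗₀ B′} {s : B′ ⇒ B} →
                 b ∘ b′ ≈ s →
                 Convolve (u ∘ (a ⊗₁ b)) ((a′ ⊗₁ b′) ∘ v) ≈
                 ((c̄ X ∘ (id ⊗₁ a′)) ⊗₁ (u ∘ (id ⊗₁ s))) ∘ mid ∘
                 (((id ⊗₁ a) ∘ c X) ⊗₁ v)
    convolve-⊗ {X} {a = a} {b} {u} {a′} {b′} {v} {s} p = begin
      (c̄ X ⊗₁ (u ∘ (a ⊗₁ b))) ∘ mid ∘ (c X ⊗₁ ((a′ ⊗₁ b′) ∘ v))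
        ≈⟨ refl⟩∘⟨ refl⟩∘⟨
             ⊗-merge (trans (⊗-identity ⟩∘⟨refl) identityˡ) refl ⟨
      (c̄ X ⊗₁ (u ∘ (a ⊗₁ b))) ∘ mid ∘ ((id ⊗₁ id) ⊗₁ (a′ ⊗₁ b′)) ∘ (c X ⊗₁ v)
        ≈⟨ refl⟩∘⟨ extendʳ mid-natural ⟩
      (c̄ X ⊗₁ (u ∘ (a ⊗₁ b))) ∘ ((id ⊗₁ a′) ⊗₁ (id ⊗₁ b′)) ∘ mid ∘ (c X ⊗₁ v)
        -- `b` and `b′` collapse to `s`, which stays on the left; `a` is kept on the right so that
        -- it can slide back through `mid`.
        ≈⟨ extendʳ (⊗-square (sym identityʳ)
             (trans (pullʳ (⊗-square (sym id-comm) (trans p (sym identityʳ))))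
                    (sym assoc))) ⟩
      ((c̄ X ∘ (id ⊗₁ a′)) ⊗₁ (u ∘ (id ⊗₁ s))) ∘ (id ⊗₁ (a ⊗₁ id)) ∘ mid ∘
      (c X ⊗₁ v)
        ≈⟨ refl⟩∘⟨ extendʳ
             (trans (⊗-cong (sym ⊗-identity) refl ⟩∘⟨refl) (sym mid-natural)) ⟩
      ((c̄ X ∘ (id ⊗₁ a′)) ⊗₁ (u ∘ (id ⊗₁ s))) ∘ mid ∘
      ((id ⊗₁ a) ⊗₁ (id ⊗₁ id)) ∘ (c X ⊗₁ v)
        ≈⟨ refl⟩∘⟨ refl⟩∘⟨
             ⊗-merge refl (trans (⊗-identity ⟩∘⟨refl) identityˡ) ⟩
      ((c̄ X ∘ (id ⊗₁ a′)) ⊗₁ (u ∘ (id ⊗₁ s))) ∘ mid ∘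
      (((id ⊗₁ a) ∘ c X) ⊗₁ v) ∎

    convolve-0 : {a : ! X ⇒ A} {b : ! X ⇒ B} {u : A ⊗₀ B ⇒ X}
                 {a′ : D ⇒ ! X} {b′ : B′ ⇒ ! X} {v : X ⇒ D ⊗₀ B′} →
                 b ∘ b′ ≈ 0ₘ →
                 Convolve (u ∘ (a ⊗₁ b)) ((a′ ⊗₁ b′) ∘ v) ≈ 0ₘ
    convolve-0 p = trans (convolve-⊗ p) (trans
      (trans (refl⟩⊗⟨ trans (refl⟩∘⟨ ⊗-zeroʳ) ∘-zeroʳ) ⊗-zeroʳ ⟩∘⟨refl) ∘-zeroˡ)

    convolve-id : {a : ! X ⇒ A} {b : ! X ⇒ B} {u : A ⊗₀ B ⇒ X}
                  {a′ : D ⇒ ! X} {b′ : B ⇒ ! X} {v : X ⇒ D ⊗₀ B} →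
                  b ∘ b′ ≈ id →
                  Convolve (u ∘ (a ⊗₁ b)) ((a′ ⊗₁ b′) ∘ v) ≈
                  ((c̄ X ∘ (id ⊗₁ a′)) ⊗₁ u) ∘ mid ∘ (((id ⊗₁ a) ∘ c X) ⊗₁ v)
    convolve-id p = trans (convolve-⊗ p)
      ((refl⟩⊗⟨ trans (refl⟩∘⟨ ⊗-identity) identityʳ) ⟩∘⟨refl)

  -- The analogue of the commutation relation of annihilation and creation operators. The bialgebra
  -- law `c∘c̄` separates product from coproduct; `d` is a derivation and `d̄` is primitive, so four
  -- terms arise.
  ∂∘∂̄ : ∀ X → ∂ X ∘ ∂̄ X ≈ id + Q X
  ∂∘∂̄ X = begin
    ((id ⊗₁ d X) ∘ c X) ∘ c̄ X ∘ (id ⊗₁ d̄ X)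
      ≈⟨ pullʳ (pullˡ (B.c∘c̄ X)) ⟩
    (id ⊗₁ d X) ∘ ((c̄ X ⊗₁ c̄ X) ∘ mid ∘ (c X ⊗₁ c X)) ∘ (id ⊗₁ d̄ X)
      ≈⟨ refl⟩∘⟨ trans assoc (refl⟩∘⟨ pullʳ (⊗-merge identityʳ refl)) ⟩
    (id ⊗₁ d X) ∘ (c̄ X ⊗₁ c̄ X) ∘ mid ∘ (c X ⊗₁ (c X ∘ d̄ X))
      ≈⟨ pullˡ (⊗-merge identityˡ refl) ⟩
    Convolve (d X ∘ c̄ X) (c X ∘ d̄ X)
      ≈⟨ convolve-cong (d∘c̄ X) (c∘d̄ X) ⟩
    Convolve (ρ⇒ ∘ (d X ⊗₁ w X) + λ⇒ ∘ (w X ⊗₁ d X))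
             ((d̄ X ⊗₁ w̄ X) ∘ ρ⇐ + (w̄ X ⊗₁ d̄ X) ∘ λ⇐)
      ≈⟨ trans convolve-+ˡ (+-cong convolve-+ʳ convolve-+ʳ) ⟩
    (Convolve (ρ⇒ ∘ (d X ⊗₁ w X)) ((d̄ X ⊗₁ w̄ X) ∘ ρ⇐) +
     Convolve (ρ⇒ ∘ (d X ⊗₁ w X)) ((w̄ X ⊗₁ d̄ X) ∘ λ⇐)) +
    (Convolve (λ⇒ ∘ (w X ⊗₁ d X)) ((d̄ X ⊗₁ w̄ X) ∘ ρ⇐) +
     Convolve (λ⇒ ∘ (w X ⊗₁ d X)) ((w̄ X ⊗₁ d̄ X) ∘ λ⇐))
      -- The four terms are decided, in order, by `w ∘ w̄`, `w ∘ d̄`, `d ∘ w̄` and `d ∘ d̄`; the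
      -- middle two vanish.
      ≈⟨ +-cong (+-cong transposed (convolve-0 (w∘d̄ X)))
                (+-cong (convolve-0 (d∘w̄ X)) straight) ⟩
    (Q X + 0ₘ) + (0ₘ + id)
      ≈⟨ trans (+-cong (+-identityʳ _) (+-identityˡ _)) (+-comm _ _) ⟩
    id + Q X ∎
    where
    transposed : Convolve (ρ⇒ ∘ (d X ⊗₁ w X)) ((d̄ X ⊗₁ w̄ X) ∘ ρ⇐) ≈ Q X
    transposed = begin
      Convolve (ρ⇒ ∘ (d X ⊗₁ w X)) ((d̄ X ⊗₁ w̄ X) ∘ ρ⇐)
        ≈⟨ convolve-id (B.w∘w̄ X) ⟩
      (∂̄ X ⊗₁ ρ⇒) ∘ mid ∘ (∂ X ⊗₁ ρ⇐)
        ≈⟨ trans (sym split-⊗ ⟩∘⟨refl) assoc ⟩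
      (∂̄ X ⊗₁ id) ∘ (id ⊗₁ ρ⇒) ∘ mid ∘ (∂ X ⊗₁ ρ⇐)
        ≈⟨ refl⟩∘⟨ extendʳ mid-unitorʳ ⟩
      (∂̄ X ⊗₁ id) ∘ σ₂₃ ∘ (id ⊗₁ ρ⇒) ∘ (∂ X ⊗₁ ρ⇐)
        ≈⟨ refl⟩∘⟨ refl⟩∘⟨ ⊗-merge identityˡ ρ-isoʳ ⟩
      Q X ∎

    straight : Convolve (λ⇒ ∘ (w X ⊗₁ d X)) ((w̄ X ⊗₁ d̄ X) ∘ λ⇐) ≈ id
    straight = begin
      Convolve (λ⇒ ∘ (w X ⊗₁ d X)) ((w̄ X ⊗₁ d̄ X) ∘ λ⇐)
        ≈⟨ convolve-id (d∘d̄ X) ⟩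
      ((c̄ X ∘ (id ⊗₁ w̄ X)) ⊗₁ λ⇒) ∘ mid ∘ (((id ⊗₁ w X) ∘ c X) ⊗₁ λ⇐)
        ≈⟨ refl⟩∘⟨ trans (mid-𝟏 ⟩∘⟨refl) identityˡ ⟩
      ((c̄ X ∘ (id ⊗₁ w̄ X)) ⊗₁ λ⇒) ∘ (((id ⊗₁ w X) ∘ c X) ⊗₁ λ⇐)
        ≈⟨ ⊗-merge units λ-isoʳ ⟩
      id ⊗₁ id
        ≈⟨ ⊗-identity ⟩
      id ∎
      where
      units : (c̄ X ∘ (id ⊗₁ w̄ X)) ∘ (id ⊗₁ w X) ∘ c X ≈ id
      units = begin
        (c̄ X ∘ (id ⊗₁ w̄ X)) ∘ (id ⊗₁ w X) ∘ c X
          -- Passing through `! X` itself separates the counit law from the unit law.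
          ≈⟨ refl⟩∘⟨ cancelˡ ρ-isoˡ ⟨
        (c̄ X ∘ (id ⊗₁ w̄ X)) ∘ ρ⇐ ∘ ρ⇒ ∘ (id ⊗₁ w X) ∘ c X
          ≈⟨ refl⟩∘⟨ trans (refl⟩∘⟨ B.counitʳ X) identityʳ ⟩
        (c̄ X ∘ (id ⊗₁ w̄ X)) ∘ ρ⇐
          ≈⟨ trans assoc (B.unitʳ X) ⟩
        id ∎

  -- By associativity the two `d̄` factors are first multiplied together, and commutativity absorbs
  -- their exchange. Thus `∂̄` itself satisfies the hypothesis made on `f`.
  ∂̄-symmetric : ∀ X → ∂̄ X ∘ (∂̄ X ⊗₁ id) ∘ σ₂₃ ≈ ∂̄ X ∘ (∂̄ X ⊗₁ id)
  ∂̄-symmetric X = begin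
    ∂̄ X ∘ (∂̄ X ⊗₁ id) ∘ σ₂₃
      ≈⟨ trans (sym assoc) (expand ⟩∘⟨refl) ⟩
    (c̄ X ∘ (id ⊗₁ c̄ X) ∘ α⇒ ∘ ((id ⊗₁ d̄ X) ⊗₁ d̄ X)) ∘ σ₂₃
      ≈⟨ pullʳ (pullʳ (pullʳ (sym σ₂₃-natural))) ⟩
    c̄ X ∘ (id ⊗₁ c̄ X) ∘ α⇒ ∘ (α⇐ ∘ (id ⊗₁ σ) ∘ α⇒) ∘ ((id ⊗₁ d̄ X) ⊗₁ d̄ X)
      ≈⟨ refl⟩∘⟨ refl⟩∘⟨ trans (refl⟩∘⟨ assoc) (cancelˡ α-isoʳ) ⟩
    c̄ X ∘ (id ⊗₁ c̄ X) ∘ ((id ⊗₁ σ) ∘ α⇒) ∘ ((id ⊗₁ d̄ X) ⊗₁ d̄ X)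
      ≈⟨ refl⟩∘⟨ trans (refl⟩∘⟨ assoc)
           (pullˡ (⊗-merge identityˡ (B.commutative X))) ⟩
    c̄ X ∘ (id ⊗₁ c̄ X) ∘ α⇒ ∘ ((id ⊗₁ d̄ X) ⊗₁ d̄ X)
      ≈⟨ expand ⟨
    ∂̄ X ∘ (∂̄ X ⊗₁ id) ∎
    where
    expand : ∂̄ X ∘ (∂̄ X ⊗₁ id) ≈
             c̄ X ∘ (id ⊗₁ c̄ X) ∘ α⇒ ∘ ((id ⊗₁ d̄ X) ⊗₁ d̄ X)
    expand = begin
      (c̄ X ∘ (id ⊗₁ d̄ X)) ∘ ((c̄ X ∘ (id ⊗₁ d̄ X)) ⊗₁ id)
        ≈⟨ pullʳ (⊗-square identityˡ (sym id-comm)) ⟩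
      c̄ X ∘ (c̄ X ⊗₁ id) ∘ ((id ⊗₁ d̄ X) ⊗₁ d̄ X)
        ≈⟨ extendʳ (B.associative X) ⟩
      c̄ X ∘ ((id ⊗₁ c̄ X) ∘ α⇒) ∘ ((id ⊗₁ d̄ X) ⊗₁ d̄ X)
        ≈⟨ refl⟩∘⟨ assoc ⟩
      c̄ X ∘ (id ⊗₁ c̄ X) ∘ α⇒ ∘ ((id ⊗₁ d̄ X) ⊗₁ d̄ X) ∎

  -- Dual argument, by coassociativity and cocommutativity.
  ∂-symmetric : ∀ X → σ₂₃ ∘ (∂ X ⊗₁ id) ∘ ∂ X ≈ (∂ X ⊗₁ id) ∘ ∂ X
  ∂-symmetric X = begin
    σ₂₃ ∘ (∂ X ⊗₁ id) ∘ ∂ X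
      ≈⟨ refl⟩∘⟨ expand ⟩
    σ₂₃ ∘ ((id ⊗₁ d X) ⊗₁ d X) ∘ α⇐ ∘ (id ⊗₁ c X) ∘ c X
      ≈⟨ extendʳ σ₂₃-natural ⟩
    ((id ⊗₁ d X) ⊗₁ d X) ∘ (α⇐ ∘ (id ⊗₁ σ) ∘ α⇒) ∘ α⇐ ∘ (id ⊗₁ c X) ∘ c X
      ≈⟨ refl⟩∘⟨ pullʳ (pullʳ (cancelˡ α-isoʳ)) ⟩
    ((id ⊗₁ d X) ⊗₁ d X) ∘ α⇐ ∘ (id ⊗₁ σ) ∘ (id ⊗₁ c X) ∘ c X
      ≈⟨ refl⟩∘⟨ refl⟩∘⟨ pullˡ (⊗-merge identityˡ (B.cocommutative X)) ⟩
    ((id ⊗₁ d X) ⊗₁ d X) ∘ α⇐ ∘ (id ⊗₁ c X) ∘ c X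
      ≈⟨ expand ⟨
    (∂ X ⊗₁ id) ∘ ∂ X ∎
    where
    expand : (∂ X ⊗₁ id) ∘ ∂ X ≈
             ((id ⊗₁ d X) ⊗₁ d X) ∘ α⇐ ∘ (id ⊗₁ c X) ∘ c X
    expand = begin
      (((id ⊗₁ d X) ∘ c X) ⊗₁ id) ∘ (id ⊗₁ d X) ∘ c X
        ≈⟨ extendʳ (⊗-square identityʳ id-comm) ⟩
      ((id ⊗₁ d X) ⊗₁ d X) ∘ (c X ⊗₁ id) ∘ c X
        ≈⟨ refl⟩∘⟨ cancelˡ α-isoˡ ⟨
      ((id ⊗₁ d X) ⊗₁ d X) ∘ α⇐ ∘ α⇒ ∘ (c X ⊗₁ id) ∘ c X
        ≈⟨ refl⟩∘⟨ refl⟩∘⟨ B.coassociative X ⟩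
      ((id ⊗₁ d X) ⊗₁ d X) ∘ α⇐ ∘ (id ⊗₁ c X) ∘ c X ∎

  N : ∀ X → ! X ⇒ ! X
  N X = ∂̄ X ∘ ∂ X

  J⊗id : ∀ X → J X ⊗₁ id {A} ≈ id + N X ⊗₁ id
  J⊗id X = trans ⊗-distribʳ-+ (+-cong ⊗-identity refl)

  -- Symmetry absorbs the crossing in `Q`, so that `∂̄ ⊗ id` meets `∂ ⊗ id`. It is stated for
  -- general `f` because it serves twice: for `∂̄` in `N∘∂̄` and for the given morphism at the end.
  symmetric⇒∂∘∂̄ : ∀ {Y} {f : ! X ⊗₀ X ⇒ Y} →
    f ∘ (∂̄ X ⊗₁ id) ∘ σ₂₃ ≈ f ∘ (∂̄ X ⊗₁ id) →
    f ∘ ∂ X ∘ ∂̄ X ≈ f ∘ (J X ⊗₁ id)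
  symmetric⇒∂∘∂̄ {X} {f = f} p = begin
    f ∘ ∂ X ∘ ∂̄ X
      ≈⟨ trans (refl⟩∘⟨ ∂∘∂̄ X) ∘-distribˡ-+ ⟩
    f ∘ id + f ∘ (∂̄ X ⊗₁ id) ∘ σ₂₃ ∘ (∂ X ⊗₁ id)
      ≈⟨ +-cong refl (trans (refl⟩∘⟨ sym assoc) (extendʳ p)) ⟩
    f ∘ id + f ∘ (∂̄ X ⊗₁ id) ∘ (∂ X ⊗₁ id)
      ≈⟨ +-cong refl (refl⟩∘⟨ ⊗-merge refl identityˡ) ⟩
    f ∘ id + f ∘ (N X ⊗₁ id)
      ≈⟨ ∘-distribˡ-+ ⟨
    f ∘ (id + N X ⊗₁ id)
      ≈⟨ refl⟩∘⟨ J⊗id X ⟨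
    f ∘ (J X ⊗₁ id) ∎

  N∘∂̄ : ∀ X → N X ∘ ∂̄ X ≈ ∂̄ X ∘ (J X ⊗₁ id)
  N∘∂̄ X = trans assoc (symmetric⇒∂∘∂̄ (∂̄-symmetric X))

  ∂∘N : ∀ X → ∂ X ∘ N X ≈ (J X ⊗₁ id) ∘ ∂ X
  ∂∘N X = begin
    ∂ X ∘ ∂̄ X ∘ ∂ X
      ≈⟨ trans (pullˡ (∂∘∂̄ X)) ∘-distribʳ-+ ⟩
    id ∘ ∂ X + ((∂̄ X ⊗₁ id) ∘ σ₂₃ ∘ (∂ X ⊗₁ id)) ∘ ∂ X
      ≈⟨ +-cong refl (pullʳ (trans assoc (∂-symmetric X))) ⟩
    id ∘ ∂ X + (∂̄ X ⊗₁ id) ∘ (∂ X ⊗₁ id) ∘ ∂ X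
      ≈⟨ +-cong refl (pullˡ (⊗-merge refl identityˡ)) ⟩
    id ∘ ∂ X + (N X ⊗₁ id) ∘ ∂ X
      ≈⟨ ∘-distribʳ-+ ⟨
    (id + N X ⊗₁ id) ∘ ∂ X
      ≈⟨ J⊗id X ⟩∘⟨refl ⟨
    (J X ⊗₁ id) ∘ ∂ X ∎

  -- `N` passes `∂̄` by turning into `J ⊗ id`. This acts only on the first of three factors, which
  -- `σ₂₃` leaves in place, and it turns back into `N` on passing `∂`.
  N⊗id-commutes-Q : ∀ X → (N X ⊗₁ id) ∘ Q X ≈ Q X ∘ (N X ⊗₁ id)
  N⊗id-commutes-Q X = begin
    (N X ⊗₁ id) ∘ (∂̄ X ⊗₁ id) ∘ σ₂₃ ∘ (∂ X ⊗₁ id)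
      ≈⟨ extendʳ (⊗-square (N∘∂̄ X) refl) ⟩
    (∂̄ X ⊗₁ id) ∘ ((J X ⊗₁ id) ⊗₁ id) ∘ σ₂₃ ∘ (∂ X ⊗₁ id)
      ≈⟨ refl⟩∘⟨ extendʳ σ₂₃-natural ⟨
    (∂̄ X ⊗₁ id) ∘ σ₂₃ ∘ ((J X ⊗₁ id) ⊗₁ id) ∘ (∂ X ⊗₁ id)
      ≈⟨ refl⟩∘⟨ refl⟩∘⟨ ⊗-square (∂∘N X) refl ⟨
    (∂̄ X ⊗₁ id) ∘ σ₂₃ ∘ (∂ X ⊗₁ id) ∘ (N X ⊗₁ id)
      ≈⟨ trans assoc (refl⟩∘⟨ assoc) ⟨
    Q X ∘ (N X ⊗₁ id) ∎

  id+-commute : {a b : A ⇒ A} → a ∘ b ≈ b ∘ a → (id + a) ∘ b ≈ b ∘ (id + a)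
  id+-commute p = trans ∘-distribʳ-+
    (trans (+-cong id-comm p) (sym ∘-distribˡ-+))

  J⊗id-commutes-∂∘∂̄ : ∀ X →
    (J X ⊗₁ id) ∘ ∂ X ∘ ∂̄ X ≈ (∂ X ∘ ∂̄ X) ∘ (J X ⊗₁ id)
  J⊗id-commutes-∂∘∂̄ X = begin
    (J X ⊗₁ id) ∘ ∂ X ∘ ∂̄ X          ≈⟨ ∘-cong (J⊗id X) (∂∘∂̄ X) ⟩
    -- `id+-commute` is used twice: the inner use adds the identity to `Q`, the outer one to
    -- `N ⊗ id`.
    (id + N X ⊗₁ id) ∘ (id + Q X)    ≈⟨ id+-commute (sym
      (id+-commute (sym (N⊗id-commutes-Q X)))) ⟩
    (id + Q X) ∘ (id + N X ⊗₁ id)    ≈⟨ ∘-cong (∂∘∂̄ X) (J⊗id X) ⟨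
    (∂ X ∘ ∂̄ X) ∘ (J X ⊗₁ id)        ∎

proposition13 :
  ∀ {k ℓk o ℓ e} {K : CommutativeSemiring k ℓk} {C : Category o ℓ e}
    {S : StarAutonomous C} {P : Preadditive K S} (E : ExponentialStructure P) →
  let open Category C
      open StarAutonomous S
      open ExponentialStructure E
  in
  HasAntiderivatives →
  ∀ (X Y : Obj) (f : ! X ⊗₀ X ⇒ Y) →
  f ∘ (∂̄ X ⊗₁ id) ∘ σ₂₃ ≈ f ∘ (∂̄ X ⊗₁ id) →
  ∃[ g ] g ∘ ∂̄ X ≈ f
proposition13 {C = C} {S = S} E J-isIso X Y f f-symmetric =
  -- Compare the Poincaré lemma: where `N` acts as multiplication by n, `J⁻¹` divides by n + 1, as
  -- does integrating t^n over [0,1].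
  f ∘ (J⁻¹ ⊗₁ id) ∘ ∂ X , (begin
    (f ∘ (J⁻¹ ⊗₁ id) ∘ ∂ X) ∘ ∂̄ X
      ≈⟨ pullʳ assoc ⟩
    f ∘ (J⁻¹ ⊗₁ id) ∘ ∂ X ∘ ∂̄ X
      -- Commutation with `J ⊗ id` passes to its inverse, which brings `∂ ∘ ∂̄` next to `f`.
      ≈⟨ refl⟩∘⟨ inverse-square (⊗id-inverse isoˡ) (⊗id-inverse isoʳ)
           (J⊗id-commutes-∂∘∂̄ X) ⟩
    f ∘ (∂ X ∘ ∂̄ X) ∘ (J⁻¹ ⊗₁ id)
      ≈⟨ extendʳ (symmetric⇒∂∘∂̄ f-symmetric) ⟩
    f ∘ (J X ⊗₁ id) ∘ (J⁻¹ ⊗₁ id)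
      ≈⟨ trans (refl⟩∘⟨ ⊗id-inverse isoʳ) identityʳ ⟩
    f ∎)
  where
  open Category C
  open StarAutonomous S
  open ExponentialStructure E
  open HomReasoning C
  open Coherence symmetricMonoidal
  open Derivatives E
  open Isomorphisms.IsIso (J-isIso X) renaming (inv to J⁻¹)

  ⊗id-inverse : ∀ {a b : ! X ⇒ ! X} → a ∘ b ≈ id →
                (a ⊗₁ id {X}) ∘ (b ⊗₁ id) ≈ id
  ⊗id-inverse p = trans (⊗-merge p identityˡ) ⊗-identity
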